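{- For every complete 4-partite graph $G$ on at least five vertices, $\tau(G)\le\frac{3}{2}\nu(G)$. Moreover, this bound is tight: there is a complete 4-partite graph $G$ (namely the one on $5$ vertices) with $\tau(G)=\frac{3}{2}\nu(G)$.
   Context: A complete 4-partite graph $G=(A,B,C,D,E(G))$ is a graph whose vertex set is partitioned into four nonempty independent sets $A,B,C,D$ such that any two vertices in different parts are adjacent. $\tau(G)$ is the minimum size of a set of edges whose removal leaves a triangle-free graph, and $\nu(G)$ is the maximum number of pairwise edge-disjoint triangles in $G$. -}

module Defs where

open import Data.Nat using (ℕ; _≤_; _<_; _*_)
open import Data.Fin using (Fin; toℕ)
open import Data.Product using (Σ; _×_; _,_; ∃)
open import Data.List using (List; []; _∷_; length)
open import Data.List.Membership.Propositional using (_∈_)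
open import Data.List.Relation.Unary.All using (All)
open import Data.List.Relation.Unary.Any using (Any)
open import Data.List.Relation.Unary.Unique.Propositional using (Unique)
open import Data.List.Relation.Unary.AllPairs using (AllPairs)
open import Relation.Binary.PropositionalEquality using (_≡_; _≢_)
open import Relation.Nullary using (¬_)
open import Function using (Surjective)

-- A complete 4-partite graph on vertex set Fin n is given by the part map
-- part : Fin n → Fin 4 (vertex v lies in part "part v"); the four parts
-- must be nonempty, i.e. part is surjective.  Two vertices are adjacent
-- iff they lie in different parts.
IsFourPartition : (n : ℕ) → (Fin n → Fin 4) → Set
IsFourPartition n part = Surjective _≡_ _≡_ part

module _ {n : ℕ} (part : Fin n → Fin 4) where

  Adj : Fin n → Fin n → Set
  Adj u v = part u ≢ part v

  -- an (unordered) edge {u,v} is represented by the pair (u , v) with u < v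
  Pair : Set
  Pair = Fin n × Fin n

  IsEdge : Pair → Set
  IsEdge (u , v) = (toℕ u < toℕ v) × Adj u v

  IsEdgeSet : List Pair → Set
  IsEdgeSet F = Unique F × All IsEdge F

  Triple : Set
  Triple = Fin n × Fin n × Fin n

  IsTriangle : Triple → Set
  IsTriangle (x , y , z) =
    (toℕ x < toℕ y) × (toℕ y < toℕ z) × Adj x y × Adj x z × Adj y z

  triEdges : Triple → List Pair
  triEdges (x , y , z) = (x , y) ∷ (x , z) ∷ (y , z) ∷ []

  -- removing F leaves a triangle-free graph: every triangle of G uses an edge of F
  IsTransversal : List Pair → Set
  IsTransversal F = IsEdgeSet F × (∀ t → IsTriangle t → Any (_∈ F) (triEdges t))

  IsTau : ℕ → Set
  IsTau k = (∃ λ F → IsTransversal F × length F ≡ k)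
          × (∀ F → IsTransversal F → k ≤ length F)

  EdgeDisjoint : Triple → Triple → Set
  EdgeDisjoint s t = ∀ e → e ∈ triEdges s → ¬ (e ∈ triEdges t)

  IsPacking : List Triple → Set
  IsPacking T = All IsTriangle T × AllPairs EdgeDisjoint T

  IsNu : ℕ → Set
  IsNu k = (∃ λ T → IsPacking T × length T ≡ k)
         × (∀ T → IsPacking T → length T ≤ k)

{-# OPTIONS --safe #-}
-- Let a ≥ b ≥ c ≥ d be the sizes of the parts A, B, C, D.  Deleting the edges inside both classes
-- of a bipartition of the parts destroys all triangles, whence τ ≤ ad + bc and τ ≤ bc + bd + cd.
--
-- For ν, join the i-th vertex of A and the j-th vertex of B to the vertex in position i + j of a
-- cyclic order of C ∪ D of length N.  Row i leaves the arc of positions i + b, …, i + N − 1 free;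
-- if C and D alternate in the cyclic order, the positions of an arc of even length are matched
-- symmetrically about its middle, always a vertex of C with one of D, and each matched pair forms
-- a further triangle with the i-th vertex of A.  With N = 2d this gives ab + a⌊(2d − b)/2⌋
-- edge-disjoint triangles when a < 2d.  It suffices except when a = b = c = 2d − 1, where N = 2d + 1
-- works.  When 2d ≤ a ≤ c + d the ab triangles of the first kind suffice, and when c + d ≤ a the
-- same construction with A as cyclic order gives b(c + d) triangles.
module Submission where

open import Defs
open import Data.Nat
open import Data.Nat.Divisibility using (divides)
open import Data.Nat.DivMod
open import Data.Nat.ListAction using (sum)
open import Data.Nat.Properties
open import Data.Nat.Tactic.RingSolver using (solve-∀)
open import Data.Empty using (⊥; ⊥-elim)
open import Data.Fin using (Fin; zero; suc; toℕ; #_)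
import Data.Fin.Properties as Finₚ
open import Data.Fin.Properties using (toℕ<n; toℕ-injective)
open import Data.List using (List; []; _∷_; map; _++_; length; lookup; allFin; filter; cartesianProduct; cartesianProductWith; concatMap; deduplicate)
open import Data.List.Properties using (length-map; length-++; length-tabulate; length-deduplicate)
import Data.List.Membership.DecPropositional as DecMembership
open import Data.List.Membership.Propositional using (_∈_; lose; find)
open import Data.List.Membership.Propositional.Properties using (∈-lookup; ∈-map⁻; ∈-filter⁺; ∈-filter⁻; ∈-allFin; ∈-concatMap⁺; ∈-concatMap⁻; ∈-cartesianProductWith⁺; ∈-cartesianProductWith⁻; ∈-deduplicate⁺)
open import Data.List.Relation.Binary.Permutation.Propositional using (_↭_; ↭-refl; ↭-sym; ↭-trans; prep; swap; ↭⇒↭ₛ)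
open import Data.List.Relation.Binary.Permutation.Propositional.Properties using (All-resp-↭; ∈-resp-↭; ↭-length)
import Data.List.Relation.Binary.Permutation.Setoid.Properties as PermSetoid
open import Data.List.Relation.Unary.All as All using (All; []; _∷_)
import Data.List.Relation.Unary.All.Properties as Allₚ
open import Data.List.Relation.Unary.AllPairs as AllPairs using (AllPairs; []; _∷_)
import Data.List.Relation.Unary.AllPairs.Properties as AllPairsₚ
open import Data.List.Relation.Unary.Any as Any using (Any; here; there)
import Data.List.Relation.Unary.Unique.DecPropositional.Properties as DecUniqueₚ
open import Data.List.Relation.Unary.Unique.Propositional using (Unique)
import Data.List.Relation.Unary.Unique.Propositional.Properties as Uniqueₚ
open import Data.Product using (_×_; _,_; proj₁; proj₂; Σ; ∃; ∃₂)
open import Data.Product.Properties using (≡-dec)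
open import Data.Sum using (_⊎_; inj₁; inj₂)
open import Data.Sum.Properties using (inj₁-injective; inj₂-injective)
open import Relation.Binary.Definitions using (tri<; tri≈; tri>)
open import Relation.Binary.PropositionalEquality
open import Relation.Nullary using (¬_; Dec; yes; no; contradiction; ¬?; _×-dec_; _→-dec_; from-yes)

-- Congruence modulo N on natural numbers

module Congruence (N : ℕ) .{{_ : NonZero N}} where

  infix 4 _≋_
  -- Multiples of `N` are added on both sides, so that congruence is expressed without subtraction
  -- and terms cancel as in ℕ.
  _≋_ : ℕ → ℕ → Set
  x ≋ y = ∃₂ λ k l → x + k * N ≡ y + l * N

  %≡⇒≋ : ∀ {x y} → x % N ≡ y % N → x ≋ y
  %≡⇒≋ {x} {y} eq = y / N , x / N , (begin
    x + y / N * N                       ≡⟨ cong (_+ y / N * N) (m≡m%n+[m/n]*n x N) ⟩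
    x % N + x / N * N + y / N * N       ≡⟨ cong (λ r → r + x / N * N + y / N * N) eq ⟩
    y % N + x / N * N + y / N * N       ≡⟨ exchange (y % N) (x / N * N) (y / N * N) ⟩
    y % N + y / N * N + x / N * N       ≡⟨ cong (_+ x / N * N) (m≡m%n+[m/n]*n y N) ⟨
    y + x / N * N                       ∎)
    where
    open ≡-Reasoning
    exchange : ∀ a b c → a + b + c ≡ a + c + b
    exchange = solve-∀

  ≋⇒≡ : ∀ {x y} → x < N → y < N → x ≋ y → x ≡ y
  ≋⇒≡ {x} {y} x<N y<N (k , l , eq) = begin
    x                 ≡⟨ m<n⇒m%n≡m x<N ⟨
    x % N             ≡⟨ [m+kn]%n≡m%n x k N ⟨
    (x + k * N) % N   ≡⟨ cong (_% N) eq ⟩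
    (y + l * N) % N   ≡⟨ [m+kn]%n≡m%n y l N ⟩
    y % N             ≡⟨ m<n⇒m%n≡m y<N ⟩
    y                 ∎
    where open ≡-Reasoning

  ≋-cancelˡ : ∀ z {x y} → z + x ≋ z + y → x ≋ y
  ≋-cancelˡ z {x} {y} (k , l , eq) = k , l ,
    +-cancelˡ-≡ z _ _ (trans (sym (+-assoc z x _)) (trans eq (+-assoc z y _)))

  ≋-+ : ∀ {x y u v} → x ≋ y → u ≋ v → x + u ≋ y + v
  ≋-+ {x} {y} {u} {v} (k , l , eq) (k′ , l′ , eq′) = k + k′ , l + l′ ,
    trans (regroup x u k k′ N) (trans (cong₂ _+_ eq eq′) (sym (regroup y v l l′ N)))
    where
    regroup : ∀ x u k k′ N → x + u + (k + k′) * N ≡ (x + k * N) + (u + k′ * N)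
    regroup = solve-∀

  ≋-sym : ∀ {x y} → x ≋ y → y ≋ x
  ≋-sym (k , l , eq) = l , k , sym eq

  %-cancelˡ : ∀ z {x y} → x < N → y < N → (z + x) % N ≡ (z + y) % N → x ≡ y
  %-cancelˡ z x<N y<N eq = ≋⇒≡ x<N y<N (≋-cancelˡ z (%≡⇒≋ eq))

  %-cancelʳ : ∀ z {x y} → x < N → y < N → (x + z) % N ≡ (y + z) % N → x ≡ y
  %-cancelʳ z {x} {y} x<N y<N eq =
    %-cancelˡ z x<N y<N (trans (cong (_% N) (+-comm z x)) (trans eq (cong (_% N) (+-comm y z))))

  -- The shifts `i` and `i′` drop out of the differences x - y and x′ - y′, which are therefore
  -- congruent; the negative terms are moved across.
  difference-≋ : ∀ i i′ x y x′ y′ → (i + x) % N ≡ (i′ + x′) % N → (i + y) % N ≡ (i′ + y′) % N →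
                 x + y′ ≋ x′ + y
  difference-≋ i i′ x y x′ y′ eqx eqy = ≋-cancelˡ (i + i′)
    (subst₂ _≋_ (regroup i i′ x y′) (trans (regroup i′ i x′ y) (cong (_+ (x′ + y)) (+-comm i′ i)))
      (≋-+ (%≡⇒≋ {i + x} {i′ + x′} eqx) (≋-sym (%≡⇒≋ {i + y} {i′ + y′} eqy))))
    where
    regroup : ∀ i i′ x y → (i + x) + (i′ + y) ≡ (i + i′) + (x + y)
    regroup = solve-∀

-- Triangles on three vertices in any order

module _ {n : ℕ} (part : Fin n → Fin 4) where

  private
    V = Fin n

  -- The case split sorts the vertices. All that is kept about an edge is that its ends are two
  -- distinct corners, so disjointness can later be argued without the order.
  triangleOn : ∀ {u v w} → Adj part u v → Adj part u w → Adj part v w →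
    Σ (Triple part) λ t → IsTriangle part t ×
      (∀ {x y} → (x , y) ∈ triEdges part t → x ∈ u ∷ v ∷ w ∷ [] × y ∈ u ∷ v ∷ w ∷ [] × x ≢ y)
  triangleOn {u} {v} {w} uv uw vw with Finₚ.<-cmp u v | Finₚ.<-cmp v w | Finₚ.<-cmp u w
  ... | tri≈ _ refl _ | _ | _ = ⊥-elim (uv refl)
  ... | _ | tri≈ _ refl _ | _ = ⊥-elim (vw refl)
  ... | _ | _ | tri≈ _ refl _ = ⊥-elim (uw refl)
  ... | tri< a _ _ | tri< b _ _ | _ = (u , v , w) , (a , b , uv , uw , vw) , λ
    { (here refl) → here refl , there (here refl) , λ { refl → uv refl }
    ; (there (here refl)) → here refl , there (there (here refl)) , λ { refl → uw refl }
    ; (there (there (here refl))) → there (here refl) , there (there (here refl)) , λ { refl → vw refl } }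
  ... | tri< a _ _ | tri> _ _ b | tri< c _ _ = (u , w , v) , (c , b , uw , uv , ≢-sym vw) , λ
    { (here refl) → here refl , there (there (here refl)) , λ { refl → uw refl }
    ; (there (here refl)) → here refl , there (here refl) , λ { refl → uv refl }
    ; (there (there (here refl))) → there (there (here refl)) , there (here refl) , λ { refl → vw refl } }
  ... | tri< a _ _ | tri> _ _ b | tri> _ _ c = (w , u , v) , (c , a , ≢-sym uw , ≢-sym vw , uv) , λ
    { (here refl) → there (there (here refl)) , here refl , λ { refl → uw refl }
    ; (there (here refl)) → there (there (here refl)) , there (here refl) , λ { refl → vw refl }
    ; (there (there (here refl))) → here refl , there (here refl) , λ { refl → uv refl } }
  ... | tri> _ _ a | tri< b _ _ | tri< c _ _ = (v , u , w) , (a , c , ≢-sym uv , vw , uw) , λ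
    { (here refl) → there (here refl) , here refl , λ { refl → uv refl }
    ; (there (here refl)) → there (here refl) , there (there (here refl)) , λ { refl → vw refl }
    ; (there (there (here refl))) → here refl , there (there (here refl)) , λ { refl → uw refl } }
  ... | tri> _ _ a | tri< b _ _ | tri> _ _ c = (v , w , u) , (b , c , vw , ≢-sym uv , ≢-sym uw) , λ
    { (here refl) → there (here refl) , there (there (here refl)) , λ { refl → vw refl }
    ; (there (here refl)) → there (here refl) , here refl , λ { refl → uv refl }
    ; (there (there (here refl))) → there (there (here refl)) , here refl , λ { refl → uw refl } }
  ... | tri> _ _ a | tri> _ _ b | _ = (w , v , u) , (b , a , ≢-sym vw , ≢-sym uw , ≢-sym uv) , λ
    { (here refl) → there (there (here refl)) , there (here refl) , λ { refl → vw refl }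
    ; (there (here refl)) → there (there (here refl)) , here refl , λ { refl → uw refl }
    ; (there (there (here refl))) → there (here refl) , here refl , λ { refl → uv refl } }

length-cartesianProductWith : ∀ {A B C : Set} (f : A → B → C) (xs : List A) (ys : List B) →
                              length (cartesianProductWith f xs ys) ≡ length xs * length ys
length-cartesianProductWith f []       ys = refl
length-cartesianProductWith f (x ∷ xs) ys = trans (length-++ (map (f x) ys))
  (cong₂ _+_ (length-map (f x) ys) (length-cartesianProductWith f xs ys))

-- Edge-disjoint triangles from shifted matchings

module ShiftedMatchings {n : ℕ} (part : Fin n → Fin 4)
  (p q N i₀ r h : ℕ) .{{_ : NonZero N}} (P Q R : ℕ → Fin n)
  (p≤N : p ≤ N) (i₀+r≤p : i₀ + r ≤ p) (q+2h≤N : q + (h + h) ≤ N)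
  -- Two offsets below 2h sum to at most 4h - 2 < N, so congruent sums of such offsets are equal.
  (4h≤N+1 : (h + h) + (h + h) ≤ suc N)
  (P-inj : ∀ {x y} → x < p → y < p → P x ≡ P y → x ≡ y)
  (Q-inj : ∀ {x y} → x < q → y < q → Q x ≡ Q y → x ≡ y)
  (R-inj : ∀ {x y} → x < N → y < N → R x ≡ R y → x ≡ y)
  (PQ : ∀ x y → Adj part (P x) (Q y))
  (PR : ∀ x y → Adj part (P x) (R y))
  (QR : ∀ x y → Adj part (Q x) (R y))
  -- The offsets q + k and q + 2h - 1 - k are symmetric about the middle of the arc of length 2h
  -- that starts at offset q.
  (RR : ∀ i k → i₀ ≤ i → i < p → k < h →
        Adj part (R ((i + (q + k)) % N)) (R ((i + (q + (h + (h ∸ suc k)))) % N)))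
  where

  open Congruence N

  -- On the left, one triangle for each pair of `P` and `Q`; on the right, one for each of the `r`
  -- rows from `i₀` on and each of the `h` matched pairs in it.
  Index : Set
  Index = (Fin p × Fin q) ⊎ (Fin r × Fin h)

  data Kind : Set where
    inP inQ inR : Kind

  vertex : Kind → ℕ → Fin n
  vertex inP = P
  vertex inQ = Q
  vertex inR = R

  bound : Kind → ℕ
  bound inP = p
  bound inQ = q
  bound inR = N

  -- Vertices of different kinds are adjacent and so lie in different parts. Hence a vertex
  -- determines its label, and edges can be compared through labels.
  vertex-injective : ∀ K K′ {x x′} → x < bound K → x′ < bound K′ →
                     vertex K x ≡ vertex K′ x′ → (K , x) ≡ (K′ , x′)
  vertex-injective inP inP a b eq = cong (inP ,_) (P-inj a b eq)
  vertex-injective inQ inQ a b eq = cong (inQ ,_) (Q-inj a b eq)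
  vertex-injective inR inR a b eq = cong (inR ,_) (R-inj a b eq)
  vertex-injective inP inQ _ _ eq = ⊥-elim (PQ _ _ (cong part eq))
  vertex-injective inP inR _ _ eq = ⊥-elim (PR _ _ (cong part eq))
  vertex-injective inQ inR _ _ eq = ⊥-elim (QR _ _ (cong part eq))
  vertex-injective inQ inP _ _ eq = ⊥-elim (PQ _ _ (cong part (sym eq)))
  vertex-injective inR inP _ _ eq = ⊥-elim (PR _ _ (cong part (sym eq)))
  vertex-injective inR inQ _ _ eq = ⊥-elim (QR _ _ (cong part (sym eq)))

  low high : Fin h → ℕ
  low  k = q + toℕ k
  high k = q + (h + (h ∸ suc (toℕ k)))

  -- The triangle with a given index consists of the vertices  vertex K x  for which  Corner t K x.
  Corner : Index → Kind → ℕ → Set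
  Corner (inj₁ (i , j)) inP x = x ≡ toℕ i
  Corner (inj₁ (i , j)) inQ x = x ≡ toℕ j
  Corner (inj₁ (i , j)) inR x = x ≡ (toℕ i + toℕ j) % N
  Corner (inj₂ (i , k)) inP x = x ≡ i₀ + toℕ i
  Corner (inj₂ (i , k)) inQ x = ⊥
  Corner (inj₂ (i , k)) inR x = x ≡ (i₀ + toℕ i + low k) % N ⊎ x ≡ (i₀ + toℕ i + high k) % N

  low+high : ∀ k → suc (toℕ k + (h + (h ∸ suc (toℕ k)))) ≡ h + h
  low+high k = begin
    suc (toℕ k + (h + (h ∸ suc (toℕ k))))   ≡⟨ regroup (toℕ k) h (h ∸ suc (toℕ k)) ⟩
    h + (suc (toℕ k) + (h ∸ suc (toℕ k)))   ≡⟨ cong (h +_) (m+[n∸m]≡n (toℕ<n k)) ⟩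
    h + h                                   ∎
    where
    open ≡-Reasoning
    regroup : ∀ k h x → suc (k + (h + x)) ≡ h + (suc k + x)
    regroup = solve-∀

  q<N : ∀ {x} → x < q → x < N
  q<N x<q = <-≤-trans x<q (≤-trans (m≤m+n q (h + h)) q+2h≤N)

  off-bound : ∀ {x} → x < h + h → q + x < N
  off-bound x< = <-≤-trans (+-monoʳ-< q x<) q+2h≤N

  k<2h : (k : Fin h) → toℕ k < h + h
  k<2h k = <-≤-trans (toℕ<n k) (m≤m+n h h)

  k̄<2h : (k : Fin h) → h + (h ∸ suc (toℕ k)) < h + h
  k̄<2h k = subst (suc (h + (h ∸ suc (toℕ k))) ≤_) (low+high k) (s≤s (m≤n+m _ (toℕ k)))

  k<k̄ : (k l : Fin h) → toℕ k < h + (h ∸ suc (toℕ l))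
  k<k̄ k l = <-≤-trans (toℕ<n k) (m≤m+n h _)

  low<N : ∀ k → low k < N
  low<N k = off-bound (k<2h k)

  high<N : ∀ k → high k < N
  high<N k = off-bound (k̄<2h k)

  low≢high : ∀ k l → low k ≢ high l
  low≢high k l eq = <⇒≢ (k<k̄ k l) (+-cancelˡ-≡ q _ _ eq)

  low-injective : ∀ k l → low k ≡ low l → k ≡ l
  low-injective k l eq = toℕ-injective (+-cancelˡ-≡ q _ _ eq)

  high-injective : ∀ k l → high k ≡ high l → k ≡ l
  high-injective k l eq = toℕ-injective (+-cancelʳ-≡ (h + (h ∸ suc (toℕ k))) _ _
    (suc-injective (trans (low+high k) (trans (sym (low+high l)) (cong (λ z → suc (toℕ l + z)) (sym (+-cancelˡ-≡ q _ _ eq)))))))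

  q-not-low : ∀ {x} k → x < q → x ≢ low k
  q-not-low k x<q refl = <⇒≱ x<q (m≤m+n q _)

  q-not-high : ∀ {x} k → x < q → x ≢ high k
  q-not-high k x<q refl = <⇒≱ x<q (m≤m+n q _)

  row<N : (i : Fin r) → i₀ + toℕ i < N
  row<N i = <-≤-trans (+-monoʳ-< i₀ (toℕ<n i)) (≤-trans i₀+r≤p p≤N)

  row-injective : (i i′ : Fin r) → i₀ + toℕ i ≡ i₀ + toℕ i′ → i ≡ i′
  row-injective i i′ eq = toℕ-injective (+-cancelˡ-≡ i₀ _ _ eq)

  fin<N : (i : Fin p) → toℕ i < N
  fin<N i = <-≤-trans (toℕ<n i) p≤N

  -- Triangles of the second kind have no corner in `Q`, and those of the first kind carry their
  -- index as the positions in `P` and `Q`.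
  P-Q-determine : ∀ s t {x y} → Corner s inP x → Corner s inQ y → Corner t inP x → Corner t inQ y → s ≡ t
  P-Q-determine (inj₁ _) (inj₁ _) a b c d =
    cong₂ (λ i j → inj₁ (i , j)) (toℕ-injective (trans (sym a) c)) (toℕ-injective (trans (sym b) d))

  Q-R-determine : ∀ s t {x y} → Corner s inQ x → Corner s inR y → Corner t inQ x → Corner t inR y → s ≡ t
  Q-R-determine (inj₁ (i , j)) (inj₁ (i′ , j′)) a b c d with toℕ-injective (trans (sym a) c)
  ... | refl = cong (λ i → inj₁ (i , j))
    (toℕ-injective (%-cancelʳ (toℕ j) (fin<N i) (fin<N i′) (trans (sym b) d)))

  -- Within a row the first kind uses offsets below `q` and the second kind offsets from `q` on; all
  -- are below `N`, so they stay distinct modulo `N`.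
  P-R-clash : ∀ i j i′ k {x y} → Corner (inj₁ (i , j)) inP x → Corner (inj₁ (i , j)) inR y →
              Corner (inj₂ (i′ , k)) inP x → Corner (inj₂ (i′ , k)) inR y → ⊥
  P-R-clash i j i′ k refl b c (inj₁ d) = q-not-low k (toℕ<n j)
    (%-cancelˡ (toℕ i) (q<N (toℕ<n j)) (low<N k)
      (trans (sym b) (trans d (cong (λ z → (z + low k) % N) (sym c)))))
  P-R-clash i j i′ k refl b c (inj₂ d) = q-not-high k (toℕ<n j)
    (%-cancelˡ (toℕ i) (q<N (toℕ<n j)) (high<N k)
      (trans (sym b) (trans d (cong (λ z → (z + high k) % N) (sym c)))))

  P-R-determine : ∀ s t {x y} → Corner s inP x → Corner s inR y → Corner t inP x → Corner t inR y → s ≡ t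
  P-R-determine (inj₁ (i , j)) (inj₁ (i′ , j′)) a b c d with toℕ-injective (trans (sym a) c)
  ... | refl = cong (λ j → inj₁ (i , j))
    (toℕ-injective (%-cancelˡ (toℕ i) (q<N (toℕ<n j)) (q<N (toℕ<n j′)) (trans (sym b) d)))
  P-R-determine (inj₁ (i , j)) (inj₂ (i′ , k)) a b c d = ⊥-elim (P-R-clash i j i′ k a b c d)
  P-R-determine (inj₂ (i , k)) (inj₁ (i′ , j)) a b c d = ⊥-elim (P-R-clash i′ j i k c d a b)
  P-R-determine (inj₂ (i , k)) (inj₂ (i′ , k′)) a b c d with row-injective i i′ (trans (sym a) c)
  ... | refl = cong (λ k → inj₂ (i , k)) (go b d)
    where
    z = i₀ + toℕ i
    go : ∀ {y} → Corner (inj₂ (i , k)) inR y → Corner (inj₂ (i , k′)) inR y → k ≡ k′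
    go (inj₁ b) (inj₁ d) = low-injective k k′ (%-cancelˡ z (low<N k) (low<N k′) (trans (sym b) d))
    go (inj₂ b) (inj₂ d) = high-injective k k′ (%-cancelˡ z (high<N k) (high<N k′) (trans (sym b) d))
    go (inj₁ b) (inj₂ d) = ⊥-elim (low≢high k k′ (%-cancelˡ z (low<N k) (high<N k′) (trans (sym b) d)))
    go (inj₂ b) (inj₁ d) = ⊥-elim (low≢high k′ k (%-cancelˡ z (low<N k′) (high<N k) (trans (sym d) b)))

  2offsets<N : ∀ {x y} → x < h + h → y < h + h → x + y < N
  2offsets<N {x} {y} x< y< = s≤s⁻¹ (≤-trans (≤-trans (≤-reflexive (regroup x y)) (+-mono-≤ x< y<)) 4h≤N+1)
    where
    regroup : ∀ x y → suc (suc (x + y)) ≡ suc x + suc y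
    regroup = solve-∀

  -- As low k + high k does not depend on k, two equal differences determine k; a difference is
  -- never the opposite of another one because all of them are smaller than N / 2.
  same-offset : ∀ i i′ k k′ → (i + low k) % N ≡ (i′ + low k′) % N →
                (i + high k) % N ≡ (i′ + high k′) % N → k ≡ k′
  same-offset i i′ k k′ eq eq′ = toℕ-injective (*-cancelˡ-≡ (toℕ k) (toℕ k′) 2 (+-cancelʳ-≡ (h̄ + h̄′) _ _ (begin
    2 * toℕ k + (h̄ + h̄′)          ≡⟨ regroup (toℕ k) h̄ h̄′ ⟩
    (toℕ k + h̄′) + (toℕ k + h̄)    ≡⟨ cong₂ _+_ diff (suc-injective (trans (low+high k) (sym (low+high k′)))) ⟩
    (toℕ k′ + h̄) + (toℕ k′ + h̄′)  ≡⟨ regroup (toℕ k′) h̄′ h̄ ⟨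
    2 * toℕ k′ + (h̄′ + h̄)         ≡⟨ cong (2 * toℕ k′ +_) (+-comm h̄′ h̄) ⟩
    2 * toℕ k′ + (h̄ + h̄′)         ∎)))
    where
    open ≡-Reasoning
    h̄  = h + (h ∸ suc (toℕ k))
    h̄′ = h + (h ∸ suc (toℕ k′))
    regroup : ∀ k x y → 2 * k + (x + y) ≡ (k + y) + (k + x)
    regroup = solve-∀
    diff : toℕ k + h̄′ ≡ toℕ k′ + h̄
    diff = ≋⇒≡ (2offsets<N (k<2h k) (k̄<2h k′)) (2offsets<N (k<2h k′) (k̄<2h k))
      (difference-≋ (i + q) (i′ + q) (toℕ k) h̄ (toℕ k′) h̄′
        (trans (cong (_% N) (+-assoc i q _)) (trans eq (cong (_% N) (sym (+-assoc i′ q _)))))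
        (trans (cong (_% N) (+-assoc i q _)) (trans eq′ (cong (_% N) (sym (+-assoc i′ q _))))))

  no-swap : ∀ i i′ k k′ → (i + low k) % N ≡ (i′ + high k′) % N →
            (i + high k) % N ≡ (i′ + low k′) % N → ⊥
  no-swap i i′ k k′ eq eq′ = <⇒≢ (+-mono-< (k<k̄ k k′) (k<k̄ k′ k)) diff
    where
    h̄  = h + (h ∸ suc (toℕ k))
    h̄′ = h + (h ∸ suc (toℕ k′))
    diff : toℕ k + toℕ k′ ≡ h̄′ + h̄
    diff = ≋⇒≡ (2offsets<N (k<2h k) (k<2h k′)) (2offsets<N (k̄<2h k′) (k̄<2h k))
      (difference-≋ (i + q) (i′ + q) (toℕ k) h̄ h̄′ (toℕ k′)
        (trans (cong (_% N) (+-assoc i q _)) (trans eq (cong (_% N) (sym (+-assoc i′ q _)))))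
        (trans (cong (_% N) (+-assoc i q _)) (trans eq′ (cong (_% N) (sym (+-assoc i′ q _))))))

  -- Triangles of the first kind have a single corner in `R`. For two of the second kind, either the
  -- pairs agree end by end, which fixes `k` and then the row, or they are swapped, which `no-swap`
  -- excludes.
  R-R-determine : ∀ s t {x y} → x ≢ y → Corner s inR x → Corner s inR y → Corner t inR x → Corner t inR y → s ≡ t
  R-R-determine (inj₁ _) _ x≢y a b c d = ⊥-elim (x≢y (trans a (sym b)))
  R-R-determine (inj₂ _) (inj₁ _) x≢y a b c d = ⊥-elim (x≢y (trans c (sym d)))
  R-R-determine (inj₂ (i , k)) (inj₂ (i′ , k′)) x≢y = go x≢y
    where
    z  = i₀ + toℕ i
    z′ = i₀ + toℕ i′
    same : (z + low k) % N ≡ (z′ + low k′) % N → (z + high k) % N ≡ (z′ + high k′) % N →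
           inj₂ (i , k) ≡ inj₂ (i′ , k′)
    same eq eq′ with same-offset z z′ k k′ eq eq′
    ... | refl = cong (λ i → inj₂ (i , k)) (row-injective i i′ (%-cancelʳ (low k) (row<N i) (row<N i′) eq))
    go : ∀ {x y} → x ≢ y → Corner (inj₂ (i , k)) inR x → Corner (inj₂ (i , k)) inR y →
         Corner (inj₂ (i′ , k′)) inR x → Corner (inj₂ (i′ , k′)) inR y → inj₂ (i , k) ≡ inj₂ (i′ , k′)
    go x≢y (inj₁ a) (inj₁ b) _ _ = ⊥-elim (x≢y (trans a (sym b)))
    go x≢y (inj₂ a) (inj₂ b) _ _ = ⊥-elim (x≢y (trans a (sym b)))
    go x≢y _ _ (inj₁ c) (inj₁ d) = ⊥-elim (x≢y (trans c (sym d)))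
    go x≢y _ _ (inj₂ c) (inj₂ d) = ⊥-elim (x≢y (trans c (sym d)))
    go x≢y (inj₁ a) (inj₂ b) (inj₁ c) (inj₂ d) = same (trans (sym a) c) (trans (sym b) d)
    go x≢y (inj₂ a) (inj₁ b) (inj₂ c) (inj₁ d) = same (trans (sym b) d) (trans (sym a) c)
    go x≢y (inj₁ a) (inj₂ b) (inj₂ c) (inj₁ d) = ⊥-elim (no-swap z z′ k k′ (trans (sym a) c) (trans (sym b) d))
    go x≢y (inj₂ a) (inj₁ b) (inj₁ c) (inj₂ d) = ⊥-elim (no-swap z z′ k k′ (trans (sym b) d) (trans (sym a) c))

  edge-determines : ∀ s t K K′ {x y} → (K , x) ≢ (K′ , y) →
    Corner s K x → Corner s K′ y → Corner t K x → Corner t K′ y → s ≡ t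
  edge-determines s t inP inQ _ a b c d = P-Q-determine s t a b c d
  edge-determines s t inQ inP _ a b c d = P-Q-determine s t b a d c
  edge-determines s t inP inR _ a b c d = P-R-determine s t a b c d
  edge-determines s t inR inP _ a b c d = P-R-determine s t b a d c
  edge-determines s t inQ inR _ a b c d = Q-R-determine s t a b c d
  edge-determines s t inR inQ _ a b c d = Q-R-determine s t b a d c
  edge-determines s t inR inR e a b c d = R-R-determine s t (λ x≡y → e (cong (inR ,_) x≡y)) a b c d
  -- A triangle has at most one corner in `P` and at most one in `Q`, so no edge has both ends
  -- there.
  edge-determines (inj₁ _) _ inP inP e a b _ _ = ⊥-elim (e (cong (inP ,_) (trans a (sym b))))
  edge-determines (inj₂ _) _ inP inP e a b _ _ = ⊥-elim (e (cong (inP ,_) (trans a (sym b))))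
  edge-determines (inj₁ _) _ inQ inQ e a b _ _ = ⊥-elim (e (cong (inQ ,_) (trans a (sym b))))

  IsCorner : Index → Fin n → Set
  IsCorner t v = ∃₂ λ K x → v ≡ vertex K x × x < bound K × Corner t K x

  triangle : (t : Index) → Σ (Triple part) λ T → IsTriangle part T ×
    (∀ {x y} → (x , y) ∈ triEdges part T → IsCorner t x × IsCorner t y × x ≢ y)
  triangle t@(inj₁ (i , j)) with triangleOn part (PQ (toℕ i) (toℕ j))
    (PR (toℕ i) ((toℕ i + toℕ j) % N)) (QR (toℕ j) ((toℕ i + toℕ j) % N))
  ... | T , isT , f = T , isT , λ e → corner (proj₁ (f e)) , corner (proj₁ (proj₂ (f e))) , proj₂ (proj₂ (f e))
    where
    corner : ∀ {v} → v ∈ P (toℕ i) ∷ Q (toℕ j) ∷ R ((toℕ i + toℕ j) % N) ∷ [] → IsCorner t v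
    corner (here eq)                 = inP , _ , eq , toℕ<n i , refl
    corner (there (here eq))         = inQ , _ , eq , toℕ<n j , refl
    corner (there (there (here eq))) = inR , _ , eq , m%n<n _ N , refl
  triangle t@(inj₂ (i , k)) with triangleOn part
    (PR (i₀ + toℕ i) ((i₀ + toℕ i + low k) % N)) (PR (i₀ + toℕ i) ((i₀ + toℕ i + high k) % N))
    (RR (i₀ + toℕ i) (toℕ k) (m≤m+n i₀ _) (<-≤-trans (+-monoʳ-< i₀ (toℕ<n i)) i₀+r≤p) (toℕ<n k))
  ... | T , isT , f = T , isT , λ e → corner (proj₁ (f e)) , corner (proj₁ (proj₂ (f e))) , proj₂ (proj₂ (f e))
    where
    corner : ∀ {v} → v ∈ P (i₀ + toℕ i) ∷ R ((i₀ + toℕ i + low k) % N) ∷ R ((i₀ + toℕ i + high k) % N) ∷ [] →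
             IsCorner t v
    corner (here eq)                 = inP , _ , eq , <-≤-trans (+-monoʳ-< i₀ (toℕ<n i)) i₀+r≤p , refl
    corner (there (here eq))         = inR , _ , eq , m%n<n _ N , inj₁ refl
    corner (there (there (here eq))) = inR , _ , eq , m%n<n _ N , inj₂ refl

  -- A shared edge has the same two labels in both triangles, and two labels fix the index. Distinct
  -- indices thus give edge-disjoint triangles.
  common-edge : ∀ s t e → e ∈ triEdges part (proj₁ (triangle s)) → e ∈ triEdges part (proj₁ (triangle t)) → s ≡ t
  common-edge s t (u , v) e∈s e∈t
    with proj₂ (proj₂ (triangle s)) e∈s | proj₂ (proj₂ (triangle t)) e∈t
  ... | (K , x , eu , x< , a) , (K′ , y , ev , y< , b) , u≢v
      | (L , x′ , eu′ , x′< , c) , (L′ , y′ , ev′ , y′< , d) , _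
    with vertex-injective K L x< x′< (trans (sym eu) eu′) | vertex-injective K′ L′ y< y′< (trans (sym ev) ev′)
  ... | refl | refl = edge-determines s t K K′
    (λ eq → u≢v (trans eu (trans (cong (λ w → vertex (proj₁ w) (proj₂ w)) eq) (sym ev)))) a b c d

  indices : List Index
  indices = map inj₁ (cartesianProduct (allFin p) (allFin q)) ++ map inj₂ (cartesianProduct (allFin r) (allFin h))

  indices-unique : Unique indices
  indices-unique = Uniqueₚ.++⁺
    (Uniqueₚ.map⁺ inj₁-injective (Uniqueₚ.cartesianProduct⁺ (Uniqueₚ.allFin⁺ p) (Uniqueₚ.allFin⁺ q)))
    (Uniqueₚ.map⁺ inj₂-injective (Uniqueₚ.cartesianProduct⁺ (Uniqueₚ.allFin⁺ r) (Uniqueₚ.allFin⁺ h)))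
    λ { (v∈ , w∈) → disjoint v∈ w∈ }
    where
    disjoint : ∀ {v} → v ∈ map inj₁ (cartesianProduct (allFin p) (allFin q)) →
               v ∈ map inj₂ (cartesianProduct (allFin r) (allFin h)) → ⊥
    disjoint a b with ∈-map⁻ inj₁ a | ∈-map⁻ inj₂ b
    ... | _ , _ , refl | _ , _ , ()

  length-indices : length indices ≡ p * q + r * h
  length-indices = trans (length-++ (map inj₁ (cartesianProduct (allFin p) (allFin q))))
    (cong₂ _+_ (count {p} {q} inj₁) (count {r} {h} inj₂))
    where
    count : ∀ {a b} (f : Fin a × Fin b → Index) →
            length (map f (cartesianProduct (allFin a) (allFin b))) ≡ a * b
    count {a} {b} f = trans (length-map f (cartesianProduct (allFin a) (allFin b))) (trans (length-cartesianProductWith _,_ (allFin a) (allFin b))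
      (cong₂ _*_ (length-tabulate {n = a} _) (length-tabulate {n = b} _)))

  packing : ∃ λ T → IsPacking part T × length T ≡ p * q + r * h
  packing = map (λ t → proj₁ (triangle t)) indices
    , ( Allₚ.map⁺ (All.universal (λ t → proj₁ (proj₂ (triangle t))) indices)
      , AllPairsₚ.map⁺ (AllPairs.map (λ {s} {t} s≢t e e∈s e∈t → s≢t (common-edge s t e e∈s e∈t)) indices-unique))
    , trans (length-map _ indices) length-indices

-- Parity, sorting and pigeonhole

lookup-injective : ∀ {A : Set} {xs : List A} → Unique xs → ∀ i j → lookup xs i ≡ lookup xs j → i ≡ j
lookup-injective (_ ∷ _)  zero    zero    _  = refl
lookup-injective (px ∷ _) zero    (suc j) eq = ⊥-elim (All.lookup px (∈-lookup j) eq)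
lookup-injective (px ∷ _) (suc i) zero    eq = ⊥-elim (All.lookup px (∈-lookup i) (sym eq))
lookup-injective (_ ∷ u)  (suc i) (suc j) eq = cong suc (lookup-injective u i j eq)

-- With a common remainder r, the number u + v + 1 would be 1 + 2(r + u/2 + v/2), which is odd.
parity-differs : ∀ u v w → suc (u + v) ≡ 2 * w → u % 2 ≢ v % 2
parity-differs u v w odd eq = even≢odd w (v % 2 + u / 2 + v / 2) (begin
  2 * w                                          ≡⟨ odd ⟨
  suc (u + v)                                    ≡⟨ cong suc (cong₂ _+_ (m≡m%n+[m/n]*n u 2) (m≡m%n+[m/n]*n v 2)) ⟩
  suc (u % 2 + u / 2 * 2 + (v % 2 + v / 2 * 2))  ≡⟨ cong (λ r → suc (r + u / 2 * 2 + (v % 2 + v / 2 * 2))) eq ⟩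
  suc (v % 2 + u / 2 * 2 + (v % 2 + v / 2 * 2))  ≡⟨ regroup (v % 2) (u / 2) (v / 2) ⟩
  suc (2 * (v % 2 + u / 2 + v / 2))              ∎)
  where
  open ≡-Reasoning
  regroup : ∀ r x y → 1 + (r + x * 2 + (r + y * 2)) ≡ 1 + 2 * (r + x + y)
  regroup = solve-∀

module _ {A : Set} (f : A → ℕ) where

  Decreasing : List A → Set
  Decreasing = AllPairs (λ x y → f y ≤ f x)

  insert : ∀ x xs → Decreasing xs → ∃ λ ys → ys ↭ x ∷ xs × Decreasing ys
  insert x [] [] = x ∷ [] , ↭-refl , [] ∷ []
  insert x (y ∷ ys) (py ∷ pys) with ≤-total (f y) (f x)
  ... | inj₁ y≤x = x ∷ y ∷ ys , ↭-refl , (y≤x ∷ All.map (λ z≤y → ≤-trans z≤y y≤x) py) ∷ py ∷ pys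
  ... | inj₂ x≤y with insert x ys pys
  ...   | zs , zs↭ , pzs = y ∷ zs , ↭-trans (prep y zs↭) (swap y x ↭-refl)
                         , All-resp-↭ (↭-sym zs↭) (x≤y ∷ py) ∷ pzs

  sort : ∀ xs → ∃ λ ys → ys ↭ xs × Decreasing ys
  sort [] = [] , ↭-refl , []
  sort (x ∷ xs) with sort xs
  ... | ys , ys↭ , pys with insert x ys pys
  ...   | zs , zs↭ , pzs = zs , ↭-trans zs↭ (prep x ys↭) , pzs

-- Serves to see that deleting the edges inside both classes of a bipartition of the parts hits
-- every triangle: two of its three parts share a class.
pigeonhole₂ : ∀ {A : Set} {P Q : A → Set} (L : A → A → Set) → (∀ x → P x ⊎ Q x) →
  (∀ {x y} → x ≢ y → P x → P y → L x y) → (∀ {x y} → x ≢ y → Q x → Q y → L x y) →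
  ∀ {x y z} → x ≢ y → x ≢ z → y ≢ z → L x y ⊎ L x z ⊎ L y z
pigeonhole₂ L cover p q {x} {y} {z} x≢y x≢z y≢z with cover x | cover y | cover z
... | inj₁ a | inj₁ b | _      = inj₁ (p x≢y a b)
... | inj₂ a | inj₂ b | _      = inj₁ (q x≢y a b)
... | inj₁ a | inj₂ _ | inj₁ c = inj₂ (inj₁ (p x≢z a c))
... | inj₂ a | inj₁ _ | inj₂ c = inj₂ (inj₁ (q x≢z a c))
... | inj₁ _ | inj₂ b | inj₂ c = inj₂ (inj₂ (q y≢z b c))
... | inj₂ _ | inj₁ b | inj₁ c = inj₂ (inj₂ (p y≢z b c))

-- Parts as lists of vertices, and upper bounds for τ

module FourParts {n : ℕ} (part : Fin n → Fin 4) where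

  members : Fin 4 → List (Fin n)
  members ℓ = filter (λ u → part u Finₚ.≟ ℓ) (allFin n)

  size : Fin 4 → ℕ
  size ℓ = length (members ℓ)

  ∈-members : ∀ {u ℓ} → part u ≡ ℓ → u ∈ members ℓ
  ∈-members {u} eq = ∈-filter⁺ _ (∈-allFin u) eq

  ∈-members⁻ : ∀ {u ℓ} → u ∈ members ℓ → part u ≡ ℓ
  ∈-members⁻ {ℓ = ℓ} u∈ = proj₂ (∈-filter⁻ (λ u → part u Finₚ.≟ ℓ) {xs = allFin n} u∈)

  members-unique : ∀ ℓ → Unique (members ℓ)
  members-unique ℓ = Uniqueₚ.filter⁺ _ (Uniqueₚ.allFin⁺ n)

  -- With at most one vertex in each part, the part map is injective into `Fin 4`.
  few-vertices : (∀ ℓ → size ℓ ≤ 1) → n ≤ 4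
  few-vertices small = Finₚ.injective⇒≤ {f = part} λ {u} {v} eq →
    single (members (part v)) (small (part v)) (∈-members eq) (∈-members refl)
    where
    single : ∀ (xs : List (Fin n)) → length xs ≤ 1 → ∀ {u v} → u ∈ xs → v ∈ xs → u ≡ v
    single (_ ∷ []) _ (here refl) (here refl) = refl
    single (_ ∷ _ ∷ _) (s≤s ())

  edge : Fin n → Fin n → Pair part
  edge u v with u Finₚ.<? v
  ... | yes _ = u , v
  ... | no  _ = v , u

  edge-isEdge : ∀ u v → part u ≢ part v → IsEdge part (edge u v)
  edge-isEdge u v uv with u Finₚ.<? v
  ... | yes u<v = u<v , uv
  ... | no  u≮v = ≤∧≢⇒< (≮⇒≥ u≮v) (λ eq → uv (cong part (sym (toℕ-injective eq)))) , ≢-sym uv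

  edge-< : ∀ {u v} → toℕ u < toℕ v → edge u v ≡ (u , v)
  edge-< {u} {v} u<v with u Finₚ.<? v
  ... | yes _   = refl
  ... | no  u≮v = contradiction u<v u≮v

  edge-> : ∀ {u v} → toℕ u < toℕ v → edge v u ≡ (u , v)
  edge-> {u} {v} u<v with v Finₚ.<? u
  ... | yes v<u = contradiction u<v (<-asym v<u)
  ... | no  _   = refl

  block : Fin 4 × Fin 4 → List (Pair part)
  block (ℓ , ℓ′) = cartesianProductWith edge (members ℓ) (members ℓ′)

  cost : Fin 4 × Fin 4 → ℕ
  cost (ℓ , ℓ′) = size ℓ * size ℓ′

  blocks : List (Fin 4 × Fin 4) → List (Pair part)
  blocks = concatMap block

  length-blocks : ∀ bs → length (blocks bs) ≡ sum (map cost bs)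
  length-blocks [] = refl
  length-blocks ((ℓ , ℓ′) ∷ bs) = trans (length-++ (block (ℓ , ℓ′)))
    (cong₂ _+_ (length-cartesianProductWith edge (members ℓ) (members ℓ′)) (length-blocks bs))

  -- Each unordered pair of parts is listed in one orientation, so both are looked up.
  Joined : List (Fin 4 × Fin 4) → Fin 4 → Fin 4 → Set
  Joined bs ℓ ℓ′ = (ℓ , ℓ′) ∈ bs ⊎ (ℓ′ , ℓ) ∈ bs

  ∈-blocks : ∀ {bs u v} → Joined bs (part u) (part v) → toℕ u < toℕ v → (u , v) ∈ blocks bs
  ∈-blocks {bs} {u} {v} (inj₁ b) u<v = ∈-concatMap⁺ block {xs = bs} (lose b
    (subst (_∈ block (part u , part v)) (edge-< u<v)
      (∈-cartesianProductWith⁺ edge (∈-members refl) (∈-members refl))))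
  ∈-blocks {bs} {u} {v} (inj₂ b) u<v = ∈-concatMap⁺ block {xs = bs} (lose b
    (subst (_∈ block (part v , part u)) (edge-> u<v)
      (∈-cartesianProductWith⁺ edge (∈-members refl) (∈-members refl))))

  blocks-areEdges : ∀ {bs} → All (λ b → proj₁ b ≢ proj₂ b) bs → All (IsEdge part) (blocks bs)
  blocks-areEdges {bs} distinct = All.tabulate λ {e} e∈ → isEdge e (find (∈-concatMap⁻ block {xs = bs} e∈))
    where
    isEdge : ∀ e → (∃ λ b → b ∈ bs × e ∈ block b) → IsEdge part e
    isEdge e ((ℓ , ℓ′) , b∈ , e∈)
      with u , v , u∈ , v∈ , refl ← ∈-cartesianProductWith⁻ edge (members ℓ) (members ℓ′) e∈ =
      edge-isEdge u v λ eq → All.lookup distinct b∈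
        (trans (sym (∈-members⁻ u∈)) (trans eq (∈-members⁻ v∈)))

  tau≤ : ∀ bs {t} → All (λ b → proj₁ b ≢ proj₂ b) bs →
    (∀ {x y z} → x ≢ y → x ≢ z → y ≢ z → Joined bs x y ⊎ Joined bs x z ⊎ Joined bs y z) →
    IsTau part t → t ≤ sum (map cost bs)
  tau≤ bs distinct hits (_ , minimal) = ≤-trans
    (minimal F ((DecUniqueₚ.deduplicate-! _≟ₑ_ G , Allₚ.deduplicate⁺ _≟ₑ_ (blocks-areEdges distinct)) , transversal))
    (≤-trans (length-deduplicate _≟ₑ_ G) (≤-reflexive (length-blocks bs)))
    where
    _≟ₑ_ = ≡-dec (Finₚ._≟_ {n}) (Finₚ._≟_ {n})
    G = blocks bs
    -- Deduplication makes the edges unique and can only shorten the list, so the bound on the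
    -- length survives.
    F = deduplicate _≟ₑ_ G
    transversal : ∀ T → IsTriangle part T → Any (_∈ F) (triEdges part T)
    transversal (x , y , z) (x<y , y<z , xy , xz , yz) with hits xy xz yz
    ... | inj₁ j        = here (∈-deduplicate⁺ _≟ₑ_ (∈-blocks j x<y))
    ... | inj₂ (inj₁ j) = there (here (∈-deduplicate⁺ _≟ₑ_ (∈-blocks j (<-trans x<y y<z))))
    ... | inj₂ (inj₂ j) = there (there (here (∈-deduplicate⁺ _≟ₑ_ (∈-blocks j y<z))))

  -- Enumerating parts and unions of two parts

  module Enumerated (nonEmpty : ∀ ℓ → NonZero (size ℓ)) where

    private instance
      size≢0 : ∀ {ℓ} → NonZero (size ℓ)
      size≢0 {ℓ} = nonEmpty ℓ

    -- Reading positions modulo the size makes the enumeration total on ℕ; it is injective on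
    -- positions below the size.
    at : Fin 4 → ℕ → Fin n
    at ℓ k = lookup (members ℓ) (k mod size ℓ)

    part-at : ∀ ℓ k → part (at ℓ k) ≡ ℓ
    part-at ℓ k = ∈-members⁻ (∈-lookup (k mod size ℓ))

    at-injective : ∀ ℓ {x y} → x < size ℓ → y < size ℓ → at ℓ x ≡ at ℓ y → x ≡ y
    at-injective ℓ {x} {y} x< y< eq = begin
      x                    ≡⟨ m<n⇒m%n≡m x< ⟨
      x % size ℓ           ≡⟨ Finₚ.toℕ-fromℕ< (m%n<n x (size ℓ)) ⟨
      toℕ (x mod size ℓ)   ≡⟨ cong toℕ (lookup-injective (members-unique ℓ) _ _ eq) ⟩
      toℕ (y mod size ℓ)   ≡⟨ Finₚ.toℕ-fromℕ< (m%n<n y (size ℓ)) ⟩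
      y % size ℓ           ≡⟨ m<n⇒m%n≡m y< ⟩
      y                    ∎
      where open ≡-Reasoning

    at-adj : ∀ {ℓ ℓ′} → ℓ ≢ ℓ′ → ∀ x y → Adj part (at ℓ x) (at ℓ′ y)
    at-adj ne x y eq = ne (trans (sym (part-at _ x)) (trans eq (part-at _ y)))

    at-adj₂ : ∀ {ℓ C D v} → ℓ ≢ C → ℓ ≢ D → part v ≡ C ⊎ part v ≡ D → ∀ x → Adj part (at ℓ x) v
    at-adj₂ C D (inj₁ eq) x eq′ = C (trans (sym (part-at _ x)) (trans eq′ eq))
    at-adj₂ C D (inj₂ eq) x eq′ = D (trans (sym (part-at _ x)) (trans eq′ eq))

    module Join {C D : Fin 4} (C≢D : C ≢ D) where

      join : ℕ → Fin n
      join x with x <? size C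
      ... | yes _ = at C x
      ... | no  _ = at D (x ∸ size C)

      part-join : ∀ x → part (join x) ≡ C ⊎ part (join x) ≡ D
      part-join x with x <? size C
      ... | yes _ = inj₁ (part-at C x)
      ... | no  _ = inj₂ (part-at D _)

      join-injective : ∀ {x y} → x < size C + size D → y < size C + size D → join x ≡ join y → x ≡ y
      join-injective {x} {y} x< y< eq with x <? size C | y <? size C
      ... | yes p | yes q = at-injective C p q eq
      ... | yes p | no  q = ⊥-elim (at-adj C≢D x _ (cong part eq))
      ... | no  p | yes q = ⊥-elim (at-adj C≢D y _ (cong part (sym eq)))
      ... | no  p | no  q = ∸-cancelʳ-≡ (≮⇒≥ p) (≮⇒≥ q) (at-injective D (below (≮⇒≥ p) x<) (below (≮⇒≥ q) y<) eq)
        where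
        below : ∀ {z} → size C ≤ z → z < size C + size D → z ∸ size C < size D
        below {z} c≤z z< = subst (z ∸ size C <_) (m+n∸m≡n (size C) (size D)) (∸-monoˡ-< z< c≤z)

      pick : ℕ → Fin 4
      pick zero    = C
      pick (suc _) = D

      pick-injective : ∀ {x y} → x < 2 → y < 2 → pick x ≡ pick y → x ≡ y
      pick-injective {zero}  {zero}  _ _ _ = refl
      pick-injective {suc zero} {suc zero} _ _ _ = refl
      pick-injective {zero}  {suc _} _ _ eq = ⊥-elim (C≢D eq)
      pick-injective {suc _} {zero} _ _ eq = ⊥-elim (C≢D (sym eq))
      pick-injective {suc (suc _)} (s≤s (s≤s ()))
      pick-injective {suc zero} {suc (suc _)} _ (s≤s (s≤s ()))

      -- Even positions lie in `C` and odd ones in `D`, each part being used up in its own order.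
      alternate : ℕ → Fin n
      alternate x = at (pick (x % 2)) (x / 2)

      part-alternate : ∀ x → part (alternate x) ≡ C ⊎ part (alternate x) ≡ D
      part-alternate x with x % 2
      ... | zero  = inj₁ (part-at C _)
      ... | suc _ = inj₂ (part-at D _)

      alternate-parity : ∀ x y → part (alternate x) ≡ part (alternate y) → x % 2 ≡ y % 2
      alternate-parity x y eq = pick-injective (m%n<n x 2) (m%n<n y 2)
        (trans (sym (part-at _ (x / 2))) (trans eq (part-at _ (y / 2))))

      module _ {N} (N≤2c : N ≤ 2 * size C) (N≤2d+1 : N ≤ suc (2 * size D)) where

        -- Of the first N positions, ⌈N/2⌉ are even and ⌊N/2⌋ are odd; the two hypotheses on `N`
        -- bound these numbers by the sizes of `C` and `D`.
        half< : ∀ {x} → x < N → x / 2 < size (pick (x % 2))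
        half< {x} x<N with x % 2 in eq
        ... | zero  = *-cancelˡ-< 2 (x / 2) _ (<-≤-trans (≤-<-trans (≤-reflexive
          (trans (*-comm 2 (x / 2)) (trans (cong (_+ x / 2 * 2) (sym eq)) (sym (m≡m%n+[m/n]*n x 2))))) x<N) N≤2c)
        ... | suc r = *-cancelˡ-< 2 (x / 2) _ (s≤s⁻¹ (<-≤-trans (≤-<-trans (≤-trans (s≤s (≤-trans (m≤n+m _ r)
          (≤-reflexive (cong (r +_) (*-comm 2 (x / 2))))))
          (≤-reflexive (trans (cong (_+ x / 2 * 2) (sym eq)) (sym (m≡m%n+[m/n]*n x 2))))) x<N) N≤2d+1))

        alternate-injective : ∀ {x y} → x < N → y < N → alternate x ≡ alternate y → x ≡ y
        alternate-injective {x} {y} x< y< eq = begin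
          x                  ≡⟨ m≡m%n+[m/n]*n x 2 ⟩
          x % 2 + x / 2 * 2  ≡⟨ cong₂ (λ r k → r + k * 2) same-parity half ⟩
          y % 2 + y / 2 * 2  ≡⟨ m≡m%n+[m/n]*n y 2 ⟨
          y                  ∎
          where
          open ≡-Reasoning
          same-parity = alternate-parity x y (cong part eq)
          half : x / 2 ≡ y / 2
          half = at-injective (pick (x % 2)) (half< x<)
            (subst (λ r → y / 2 < size (pick r)) (sym same-parity) (half< y<))
            (trans eq (cong (λ r → at (pick r) (y / 2)) (sym same-parity)))

    -- Packings for the different ranges of part sizes

    Packs : ℕ → Set
    Packs m = ∃ λ T → IsPacking part T × length T ≡ m

    nu≥ : ∀ {m v} → Packs m → IsNu part v → m ≤ v
    nu≥ (T , isT , refl) (_ , maximal) = maximal T isT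

    module _ {A B C D : Fin 4} (A≢B : A ≢ B) (A≢C : A ≢ C) (A≢D : A ≢ D)
             (B≢C : B ≢ C) (B≢D : B ≢ D) (C≢D : C ≢ D) where

      private
        a = size A
        b = size B
        c = size C
        d = size D

      open Join C≢D

      -- `B` supplies the rows, C ∪ D the columns and `A` the cyclic order; with r = h = 0 there are
      -- only triangles of the first kind.
      packs-b[c+d] : b ≤ a → c + d ≤ a → Packs (b * (c + d) + 0 * 0)
      packs-b[c+d] b≤a c+d≤a = ShiftedMatchings.packing part b (c + d) a 0 0 0 (at B) join (at A)
        b≤a z≤n (≤-trans (≤-reflexive (+-identityʳ _)) c+d≤a) z≤n (at-injective B) join-injective (at-injective A)
        (λ x y → at-adj₂ B≢C B≢D (part-join y) x) (at-adj (≢-sym A≢B))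
        (λ x y → ≢-sym (at-adj₂ A≢C A≢D (part-join x) y)) (λ _ _ _ _ ())

      -- Without matched pairs no edge between `C` and `D` is used, so any order of C ∪ D will do.
      packs-ab : .{{_ : NonZero (c + d)}} → a ≤ c + d → b ≤ c + d → Packs (a * b + 0 * 0)
      packs-ab a≤ b≤ = ShiftedMatchings.packing part a b (c + d) 0 0 0 (at A) (at B) join
        a≤ z≤n (≤-trans (≤-reflexive (+-identityʳ _)) b≤) z≤n (at-injective A) (at-injective B) join-injective
        (at-adj A≢B) (λ x y → at-adj₂ A≢C A≢D (part-join y) x) (λ x y → at-adj₂ B≢C B≢D (part-join y) x)
        (λ _ _ _ _ ())

      packs-alternating : ∀ h → d ≤ c → a ≤ 2 * d → b + (h + h) ≤ 2 * d →
        (h + h) + (h + h) ≤ suc (2 * d) → Packs (a * b + a * h)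
      packs-alternating h d≤c a≤ b+2h≤ 4h≤ = ShiftedMatchings.packing part a b (2 * d) 0 a h (at A) (at B) alternate
        a≤ ≤-refl b+2h≤ 4h≤ (at-injective A) (at-injective B)
        (alternate-injective (*-monoʳ-≤ 2 d≤c) (n≤1+n _))
        (at-adj A≢B) (λ x y → at-adj₂ A≢C A≢D (part-alternate y) x) (λ x y → at-adj₂ B≢C B≢D (part-alternate y) x)
        bicoloured
        where
        instance _ = m*n≢0 2 d
        -- The cyclic order has even length 2d, so parity survives the wrap-around.
        reduce : ∀ x → x % (2 * d) % 2 ≡ x % 2
        reduce x = m∣n⇒o%n%m≡o%m 2 (2 * d) x (divides d (*-comm 2 d))
        bicoloured : ∀ i k → 0 ≤ i → i < a → k < h →
          Adj part (alternate ((i + (b + k)) % (2 * d))) (alternate ((i + (b + (h + (h ∸ suc k)))) % (2 * d)))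
        bicoloured i k _ _ k<h eq = parity-differs (i + (b + k)) (i + (b + (h + (h ∸ suc k)))) (i + b + h)
          -- The two positions sum to 2(i + b + h) - 1 before reduction, so one is even and the
          -- other odd.
          (trans (regroup i b k h (h ∸ suc k)) (trans (cong (λ z → 2 * (i + b) + (h + z)) (m+[n∸m]≡n k<h)) (regroup′ i b h)))
          (trans (sym (reduce (i + (b + k)))) (trans
            (alternate-parity ((i + (b + k)) % (2 * d)) ((i + (b + (h + (h ∸ suc k)))) % (2 * d)) eq)
            (reduce (i + (b + (h + (h ∸ suc k)))))))
          where
          regroup : ∀ i b k h x → suc (i + (b + k) + (i + (b + (h + x)))) ≡ 2 * (i + b) + (h + (suc k + x))
          regroup = solve-∀
          regroup′ : ∀ i b h → 2 * (i + b) + (h + h) ≡ 2 * (i + b + h)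
          regroup′ = solve-∀

      -- An odd cyclic order of C ∪ D has one monochromatic pair of neighbours; discarding the
      -- first two rows of A keeps clear of it.
      packs-odd : ∀ r → a ≡ 2 + r → b ≡ a → suc (2 * d) ≡ a + 2 → d < c → Packs (a * b + r * 1)
      packs-odd r a≡ b≡a N≡ d<c = ShiftedMatchings.packing part a b N 2 r 1 (at A) (at B) alternate
        (≤-trans (m≤m+n a 2) (≤-reflexive (sym N≡))) (≤-reflexive (sym a≡))
        (≤-reflexive b+2≡N) (≤-trans (+-monoˡ-≤ 2 (≤-trans (m≤m+n 2 r) (≤-reflexive (sym a≡)))) (≤-trans (≤-reflexive (sym N≡)) (n≤1+n N)))
        (at-injective A) (at-injective B) (alternate-injective N≤2c ≤-refl)
        (at-adj A≢B) (λ x y → at-adj₂ A≢C A≢D (part-alternate y) x) (λ x y → at-adj₂ B≢C B≢D (part-alternate y) x)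
        bicoloured
        where
        N = suc (2 * d)
        b+2≡N : b + 2 ≡ N
        b+2≡N = trans (cong (_+ 2) b≡a) (sym N≡)
        N≤2c : N ≤ 2 * c
        N≤2c = ≤-trans (n≤1+n N) (≤-trans (≤-reflexive (sym (*-suc 2 d))) (*-monoʳ-≤ 2 d<c))
        regroup : ∀ j b k → 2 + j + (b + k) ≡ k + j + (b + 2)
        regroup = solve-∀
        -- As b + 2 = N, the two free offsets b and b + 1 of row 2 + j land on the neighbouring
        -- positions j and j + 1.
        wrap : ∀ j k → k + j < N → (2 + j + (b + k)) % N ≡ k + j
        wrap j k k+j<N = trans (cong (_% N) (trans (regroup j b k) (cong (k + j +_) b+2≡N)))
          (trans ([m+n]%n≡m%n (k + j) N) (m<n⇒m%n≡m k+j<N))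
        bicoloured : ∀ i k → 2 ≤ i → i < a → k < 1 →
          Adj part (alternate ((i + (b + k)) % N)) (alternate ((i + (b + (1 + (1 ∸ suc k)))) % N))
        bicoloured (suc (suc j)) zero (s≤s (s≤s z≤n)) i<a _ eq = parity-differs j (suc j) (suc j) (double j)
          (alternate-parity j (suc j) (trans (cong (λ z → part (alternate z)) (sym (wrap j 0 j<N)))
            (trans eq (cong (λ z → part (alternate z)) (wrap j 1 1+j<N)))))
          where
          1+j<N : suc j < N
          1+j<N = <-≤-trans (<-trans (n<1+n (suc j)) i<a) (≤-trans (m≤m+n a 2) (≤-reflexive (sym N≡)))
          j<N : j < N
          j<N = <-trans (n<1+n j) 1+j<N
          double : ∀ j → suc (j + suc j) ≡ 2 * suc j
          double = solve-∀
        bicoloured (suc zero) zero (s≤s ())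
        bicoloured _ (suc _) _ _ (s≤s ())

-- Inequalities between the part sizes

halve : ∀ k → ∃ λ h → k ≡ h + h ⊎ k ≡ suc (h + h)
halve zero = 0 , inj₁ refl
halve (suc k) with halve k
... | h , inj₁ refl = h , inj₂ refl
... | h , inj₂ refl = suc h , inj₁ (cong suc (sym (+-suc h h)))

-- The estimates below are proved in this form: slack variables replace the inequalities between
-- sizes, and the difference `e` of the two sides becomes a polynomial with natural coefficients.
≤-from-+ : ∀ {x y} e → x + e ≡ y → x ≤ y
≤-from-+ {x} e eq = ≤-trans (m≤m+n x e) (≤-reflexive eq)

-- Amounts to 2cd ≤ b(c + d), true because cd ≤ bc and cd ≤ bd.
bound-large : ∀ {b c d} → d ≤ c → c ≤ b →
              2 * (b * c + (b * d + (c * d + 0))) ≤ 3 * (b * (c + d) + 0 * 0)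
bound-large {d = d} d≤c c≤b with m≤n⇒∃[o]m+o≡n d≤c | m≤n⇒∃[o]m+o≡n c≤b
... | y , refl | x , refl = ≤-from-+ ((d + y) * y + x * (d + y + d)) (identity d y x)
  where
  identity : ∀ d y x → 2 * ((d + y + x) * (d + y) + ((d + y + x) * d + ((d + y) * d + 0)))
             + ((d + y) * y + x * (d + y + d)) ≡ 3 * ((d + y + x) * (d + y + d) + 0 * 0)
  identity = solve-∀

-- The slacks w = a - 2d, s = c + d - a, z = a - b and x = b - c determine all sizes: d = s + x + z
-- and c = d + w + s.
bound-medium : ∀ {a b c d} → 2 * d ≤ a → a ≤ c + d → b ≤ a → c ≤ b →
               2 * (a * d + (b * c + 0)) ≤ 3 * (a * b + 0 * 0)
bound-medium {a} {b} {c} {d} 2d≤a a≤c+d b≤a c≤b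
  with m≤n⇒∃[o]m+o≡n 2d≤a | m≤n⇒∃[o]m+o≡n a≤c+d | m≤n⇒∃[o]m+o≡n b≤a | m≤n⇒∃[o]m+o≡n c≤b
... | w , 2d+w≡a | s , a+s≡c+d | z , refl | x , refl = go c≡ d≡
  where
  join : ∀ d w → d + w + d ≡ 2 * d + w
  join = solve-∀
  split : ∀ d w s → 2 * d + w + s ≡ d + w + s + d
  split = solve-∀
  split′ : ∀ d w s x z → d + w + s + x + z ≡ d + w + (s + x + z)
  split′ = solve-∀
  identity : ∀ s x z w → 2 * ((s + x + z + w + s + x + z) * (s + x + z) + ((s + x + z + w + s + x) * (s + x + z + w + s) + 0))
             + ((2 * s + 2 * x + z + w) * (2 * x + w) + 2 * s * z + 2 * x * z + 2 * z * w)
             ≡ 3 * ((s + x + z + w + s + x + z) * (s + x + z + w + s + x) + 0 * 0)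
  identity = solve-∀
  c≡ : c ≡ d + w + s
  c≡ = +-cancelʳ-≡ d c (d + w + s) (trans (sym a+s≡c+d) (trans (cong (_+ s) (sym 2d+w≡a)) (split d w s)))
  d≡ : d ≡ s + x + z
  d≡ = +-cancelˡ-≡ (d + w) d (s + x + z) (trans (join d w) (trans 2d+w≡a
    (trans (cong (λ c → c + x + z) c≡) (split′ d w s x z))))
  go : ∀ {c d} → c ≡ d + w + s → d ≡ s + x + z →
       2 * ((c + x + z) * d + ((c + x) * c + 0)) ≤ 3 * ((c + x + z) * (c + x) + 0 * 0)
  go refl refl =
    ≤-from-+ ((2 * s + 2 * x + z + w) * (2 * x + w) + 2 * s * z + 2 * x * z + 2 * z * w) (identity s x z w)

-- Here d is known only through 2 d, hence the doubling.
double-cost : ∀ {a b c d D} → 2 * d ≡ D → 2 * (2 * (a * d + (b * c + 0))) ≡ 2 * (a * D) + 4 * (b * c)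
double-cost {a} {b} {c} {d} refl = identity a b c d
  where
  identity : ∀ a b c d → 2 * (2 * (a * d + (b * c + 0))) ≡ 2 * (a * (2 * d)) + 4 * (b * c)
  identity = solve-∀

-- The doubled difference is 4b(a - c) + 2ah.
bound-even : ∀ {a b c d h} → c ≤ a → 2 * d ≡ b + (h + h) →
             2 * (a * d + (b * c + 0)) ≤ 3 * (a * b + a * h)
bound-even {b = b} {c} {d} {h} c≤a 2d≡ with m≤n⇒∃[o]m+o≡n c≤a
... | u , refl = *-cancelˡ-≤ 2 (≤-from-+ (4 * (b * u) + 2 * ((c + u) * h))
  (trans (cong (_+ (4 * (b * u) + 2 * ((c + u) * h))) (double-cost {c + u} {b} {c} {d} 2d≡)) (identity b c h u)))
  where
  identity : ∀ b c h u → 2 * ((c + u) * (b + (h + h))) + 4 * (b * c) + (4 * (b * u) + 2 * ((c + u) * h))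
             ≡ 2 * (3 * ((c + u) * b + (c + u) * h))
  identity = solve-∀

-- One free position per row stays unmatched, which costs 2a in the doubled difference; having at
-- least one pair in each row pays for it.
bound-odd : ∀ {a b c d h} → c ≤ a → 2 * d ≡ b + suc (suc h + suc h) →
            2 * (a * d + (b * c + 0)) ≤ 3 * (a * b + a * suc h)
bound-odd {b = b} {c} {d} {h} c≤a 2d≡ with m≤n⇒∃[o]m+o≡n c≤a
... | u , refl = *-cancelˡ-≤ 2 (≤-from-+ (4 * (b * u) + 2 * ((c + u) * h))
  (trans (cong (_+ (4 * (b * u) + 2 * ((c + u) * h))) (double-cost {c + u} {b} {c} {d} 2d≡)) (identity b c h u)))
  where
  identity : ∀ b c h u → 2 * ((c + u) * (b + (1 + ((1 + h) + (1 + h))))) + 4 * (b * c) + (4 * (b * u) + 2 * ((c + u) * h))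
             ≡ 2 * (3 * ((c + u) * b + (c + u) * (1 + h)))
  identity = solve-∀

-- There are no matched pairs here; the doubled difference 4a(a - c) - 2a is still positive since c
-- < a.
bound-near-exceptional : ∀ {a c d} → c < a → 2 * d ≡ a + 1 →
                         2 * (a * d + (a * c + 0)) ≤ 3 * (a * a + a * 0)
bound-near-exceptional {c = c} {d} c<a 2d≡ with m≤n⇒∃[o]m+o≡n c<a
... | u , refl = *-cancelˡ-≤ 2 (≤-from-+ (4 * ((1 + c + u) * u) + 2 * (1 + c + u))
  (trans (cong (_+ (4 * ((1 + c + u) * u) + 2 * (1 + c + u))) (double-cost {1 + c + u} {1 + c + u} {c} {d} 2d≡)) (identity c u)))
  where
  identity : ∀ c u → 2 * ((1 + c + u) * (1 + c + u + 1)) + 4 * ((1 + c + u) * c) + (4 * ((1 + c + u) * u) + 2 * (1 + c + u))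
             ≡ 2 * (3 * ((1 + c + u) * (1 + c + u) + (1 + c + u) * 0))
  identity = solve-∀

-- Of the a rows, a - 2 = `suc r` carry one extra triangle. The doubled difference is 4(a - 3), so
-- the estimate is an equality at a = 3.
bound-exceptional : ∀ {a d} r → a ≡ 3 + r → 2 * d ≡ a + 1 →
                    2 * (a * d + (a * a + 0)) ≤ 3 * (a * a + suc r * 1)
bound-exceptional {d = d} r refl 2d≡ = *-cancelˡ-≤ 2 (≤-from-+ (4 * r)
  (trans (cong (_+ 4 * r) (double-cost {3 + r} {3 + r} {3 + r} {d} 2d≡)) (identity r)))
  where
  identity : ∀ r → 2 * ((3 + r) * (3 + r + 1)) + 4 * ((3 + r) * (3 + r)) + 4 * r
             ≡ 2 * (3 * ((3 + r) * (3 + r) + (1 + r) * 1))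
  identity = solve-∀

-- The upper bound by cases on the part sizes

module UpperBound {n : ℕ} (part : Fin n → Fin 4) (surj : IsFourPartition n part) where

  open FourParts part

  nonEmpty : ∀ ℓ → NonZero (size ℓ)
  nonEmpty ℓ with members ℓ | ∈-members {ℓ = ℓ} (proj₂ (surj ℓ) refl)
  ... | _ ∷ _ | _ = _

  open Enumerated nonEmpty

  module _ {A B C D : Fin 4} (A≢B : A ≢ B) (A≢C : A ≢ C) (A≢D : A ≢ D)
           (B≢C : B ≢ C) (B≢D : B ≢ D) (C≢D : C ≢ D)
           (cover : ∀ ℓ → ℓ ∈ A ∷ B ∷ C ∷ D ∷ []) where

    private
      a = size A
      b = size B
      c = size C
      d = size D

    -- The bipartition has the classes A ∪ D and B ∪ C.
    tau≤ad+bc : ∀ {t} → IsTau part t → t ≤ a * d + (b * c + 0)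
    tau≤ad+bc = tau≤ bs (A≢D ∷ B≢C ∷ []) (pigeonhole₂ (Joined bs) side outer inner)
      where
      bs = (A , D) ∷ (B , C) ∷ []
      side : ∀ ℓ → (ℓ ≡ A ⊎ ℓ ≡ D) ⊎ (ℓ ≡ B ⊎ ℓ ≡ C)
      side ℓ with cover ℓ
      ... | here eq                         = inj₁ (inj₁ eq)
      ... | there (here eq)                 = inj₂ (inj₁ eq)
      ... | there (there (here eq))         = inj₂ (inj₂ eq)
      ... | there (there (there (here eq))) = inj₁ (inj₂ eq)
      outer : ∀ {x y} → x ≢ y → x ≡ A ⊎ x ≡ D → y ≡ A ⊎ y ≡ D → Joined bs x y
      outer ne (inj₁ refl) (inj₁ refl) = ⊥-elim (ne refl)
      outer ne (inj₁ refl) (inj₂ refl) = inj₁ (here refl)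
      outer ne (inj₂ refl) (inj₁ refl) = inj₂ (here refl)
      outer ne (inj₂ refl) (inj₂ refl) = ⊥-elim (ne refl)
      inner : ∀ {x y} → x ≢ y → x ≡ B ⊎ x ≡ C → y ≡ B ⊎ y ≡ C → Joined bs x y
      inner ne (inj₁ refl) (inj₁ refl) = ⊥-elim (ne refl)
      inner ne (inj₁ refl) (inj₂ refl) = inj₁ (there (here refl))
      inner ne (inj₂ refl) (inj₁ refl) = inj₂ (there (here refl))
      inner ne (inj₂ refl) (inj₂ refl) = ⊥-elim (ne refl)

    -- The bipartition sets `A` against the other three parts; inside `A` there is no edge to
    -- delete.
    tau≤bc+bd+cd : ∀ {t} → IsTau part t → t ≤ b * c + (b * d + (c * d + 0))
    tau≤bc+bd+cd = tau≤ bs (B≢C ∷ B≢D ∷ C≢D ∷ []) (pigeonhole₂ (Joined bs) side single rest)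
      where
      bs = (B , C) ∷ (B , D) ∷ (C , D) ∷ []
      side : ∀ ℓ → ℓ ≡ A ⊎ ℓ ∈ B ∷ C ∷ D ∷ []
      side ℓ with cover ℓ
      ... | here eq = inj₁ eq
      ... | there p = inj₂ p
      single : ∀ {x y} → x ≢ y → x ≡ A → y ≡ A → Joined bs x y
      single ne refl refl = ⊥-elim (ne refl)
      rest : ∀ {x y} → x ≢ y → x ∈ B ∷ C ∷ D ∷ [] → y ∈ B ∷ C ∷ D ∷ [] → Joined bs x y
      rest ne (here refl)                 (here refl)                 = ⊥-elim (ne refl)
      rest ne (here refl)                 (there (here refl))         = inj₁ (here refl)
      rest ne (here refl)                 (there (there (here refl))) = inj₁ (there (here refl))
      rest ne (there (here refl))         (here refl)                 = inj₂ (here refl)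
      rest ne (there (here refl))         (there (here refl))         = ⊥-elim (ne refl)
      rest ne (there (here refl))         (there (there (here refl))) = inj₁ (there (there (here refl)))
      rest ne (there (there (here refl))) (here refl)                 = inj₂ (there (here refl))
      rest ne (there (there (here refl))) (there (here refl))         = inj₂ (there (there (here refl)))
      rest ne (there (there (here refl))) (there (there (here refl))) = ⊥-elim (ne refl)

    module _ {t v} (isTau : IsTau part t) (isNu : IsNu part v) where

      combine : ∀ {k m} → t ≤ k → Packs m → 2 * k ≤ 3 * m → 2 * t ≤ 3 * v
      combine t≤k packs 2k≤3m =
        ≤-trans (*-monoʳ-≤ 2 t≤k) (≤-trans 2k≤3m (*-monoʳ-≤ 3 (nu≥ packs isNu)))

      ordered-bound : b ≤ a → c ≤ b → d ≤ c → 2 ≤ a → 2 * t ≤ 3 * v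
      ordered-bound b≤a c≤b d≤c 2≤a with c + d ≤? a | 2 * d ≤? a
      ... | yes c+d≤a | _ = combine (tau≤bc+bd+cd isTau)
        (packs-b[c+d] A≢B A≢C A≢D B≢C B≢D C≢D b≤a c+d≤a) (bound-large d≤c c≤b)
      ... | no c+d≰a | yes 2d≤a = combine (tau≤ad+bc isTau)
        (packs-ab A≢B A≢C A≢D B≢C B≢D C≢D {{>-nonZero (≤-trans (≤-trans z<s 2≤a) a≤c+d)}} a≤c+d (≤-trans b≤a a≤c+d))
        (bound-medium 2d≤a a≤c+d b≤a c≤b)
        where a≤c+d = <⇒≤ (≰⇒> c+d≰a)
      -- Each row leaves k = 2d - b positions free, and the parity of k decides whether all of them
      -- can be matched.
      ... | no _ | no 2d≰a with m≤n⇒∃[o]m+o≡n (≤-trans b≤a (<⇒≤ (≰⇒> 2d≰a)))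
      ...   | k , b+k≡2d = by-parity (halve k)
        where
        c≤a = ≤-trans c≤b b≤a
        d≤b = ≤-trans d≤c c≤b
        a<2d = ≰⇒> 2d≰a

        alternating : ∀ h → b + (h + h) ≤ 2 * d → Packs (a * b + a * h)
        alternating h b+2h≤2d = packs-alternating A≢B A≢C A≢D B≢C B≢D C≢D h d≤c (<⇒≤ a<2d) b+2h≤2d
          (≤-trans (+-mono-≤ 2h≤d (≤-trans 2h≤d (≤-reflexive (sym (+-identityʳ d))))) (n≤1+n _))
          where
          -- From d ≤ b and b + 2h ≤ 2d; doubling gives the required 4h ≤ 2d + 1.
          2h≤d : h + h ≤ d
          2h≤d = +-cancelˡ-≤ d _ _ (≤-trans (+-monoˡ-≤ (h + h) d≤b)
            (≤-trans b+2h≤2d (≤-reflexive (cong (d +_) (+-identityʳ d)))))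

        by-parity : (∃ λ h → k ≡ h + h ⊎ k ≡ suc (h + h)) → 2 * t ≤ 3 * v
        by-parity (h , inj₁ k≡) = combine (tau≤ad+bc isTau) (alternating h (≤-reflexive (sym 2d≡)))
          (bound-even {h = h} c≤a 2d≡)
          where 2d≡ = trans (sym b+k≡2d) (cong (b +_) k≡)
        by-parity (suc h , inj₂ k≡) = combine (tau≤ad+bc isTau)
          (alternating (suc h) (≤-trans (+-monoʳ-≤ b (n≤1+n _)) (≤-reflexive (sym 2d≡))))
          (bound-odd {h = h} c≤a 2d≡)
          where 2d≡ = trans (sym b+k≡2d) (cong (b +_) k≡)
        -- Now 2d = b + 1, and b ≤ a < 2d forces a = b. Every row has a single free position, so no
        -- pair can be formed.
        by-parity (zero , inj₂ refl) with c <? a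
        ... | yes c<a = combine (subst (λ b → t ≤ a * d + (b * c + 0)) b≡a (tau≤ad+bc isTau))
          (subst (λ b → Packs (a * b + a * 0)) b≡a (alternating 0 (≤-trans (+-monoʳ-≤ b z≤n) (≤-reflexive b+k≡2d))))
          (bound-near-exceptional c<a (trans (sym b+k≡2d) (cong (_+ 1) b≡a)))
          where b≡a = ≤-antisym b≤a (s≤s⁻¹ (≤-trans a<2d (≤-reflexive (trans (sym b+k≡2d) (+-comm b 1)))))
        -- What remains is a = b = c = 2d - 1. For a = 1 this is K₄, where τ = 2 and ν = 1 break the
        -- bound; `2≤a` keeps it out.
        ... | no c≮a = exceptional (m≤n⇒∃[o]m+o≡n 2≤a)
          where
          c≡a = ≤-antisym c≤a (≮⇒≥ c≮a)
          b≡a = ≤-antisym b≤a (≤-trans (≮⇒≥ c≮a) c≤b)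
          2d≡ : 2 * d ≡ a + 1
          2d≡ = trans (sym b+k≡2d) (cong (_+ 1) b≡a)
          d<c : d < c
          d<c = *-cancelˡ-< 2 d c (subst₂ _<_ (sym 2d≡) (cong (2 *_) (sym c≡a))
            (subst (a + 1 <_) (cong (a +_) (sym (+-identityʳ a))) (+-monoʳ-< a 2≤a)))
          exceptional : (∃ λ r → 2 + r ≡ a) → 2 * t ≤ 3 * v
          -- a = 2 would give 2d = 3.
          exceptional (zero , 2≡a) = ⊥-elim (even≢odd d 1 (trans 2d≡ (cong (_+ 1) (sym 2≡a))))
          exceptional (suc r , 3+r≡a) = combine
            (subst₂ (λ b c → t ≤ a * d + (b * c + 0)) b≡a c≡a (tau≤ad+bc isTau))
            (subst (λ b → Packs (a * b + suc r * 1)) b≡a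
              (packs-odd A≢B A≢C A≢D B≢C B≢D C≢D (suc r) (sym 3+r≡a) b≡a
                (trans (cong suc 2d≡) (sym (+-suc a 1))) d<c))
            (bound-exceptional r (sym 3+r≡a) 2d≡)

  bound-all : 5 ≤ n → ∀ {t v} → IsTau part t → IsNu part v → 2 * t ≤ 3 * v
  bound-all 5≤n isTau isNu = go (sort size (allFin 4))
    where
    go : (∃ λ ys → ys ↭ allFin 4 × Decreasing size ys) → _
    go (ys , ys↭ , dec) with ↭-length ys↭ | PermSetoid.Unique-resp-↭ (setoid (Fin 4)) (↭⇒↭ₛ (↭-sym ys↭)) (Uniqueₚ.allFin⁺ 4)
                           | (λ ℓ → ∈-resp-↭ (↭-sym ys↭) (∈-allFin ℓ)) | dec
    go (A ∷ B ∷ C ∷ D ∷ [] , _ , _) | refl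
      | (A≢B ∷ A≢C ∷ A≢D ∷ []) ∷ (B≢C ∷ B≢D ∷ []) ∷ (C≢D ∷ []) ∷ [] ∷ []
      | cover | ≤a@(b≤a ∷ _) ∷ (c≤b ∷ _) ∷ (d≤c ∷ []) ∷ [] ∷ [] =
      ordered-bound A≢B A≢C A≢D B≢C B≢D C≢D cover isTau isNu b≤a c≤b d≤c
        -- If the largest part had at most one vertex, there would be at most four vertices.
        (≰⇒> λ a≤1 → <⇒≱ 5≤n (few-vertices λ ℓ → ≤-trans (All.lookup (≤-refl ∷ ≤a) (cover ℓ)) a≤1))

-- Tightness: the graph on five vertices

module K₂₁₁₁ where

  -- Vertices 0 and 1 share a part, so the graph is K₅ without the edge between them.
  part : Fin 5 → Fin 4
  part zero    = zero
  part (suc x) = x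

  surjective : IsFourPartition 5 part
  surjective ℓ = suc ℓ , λ { refl → refl }

  triangles : List (Triple part)
  triangles = (# 0 , # 2 , # 3) ∷ (# 0 , # 2 , # 4) ∷ (# 0 , # 3 , # 4)
            ∷ (# 1 , # 2 , # 3) ∷ (# 1 , # 2 , # 4) ∷ (# 1 , # 3 , # 4) ∷ (# 2 , # 3 , # 4) ∷ []

  _≟ₑ_ : (e f : Pair part) → Dec (e ≡ f)
  _≟ₑ_ = ≡-dec (Finₚ._≟_ {5}) (Finₚ._≟_ {5})

  _≟ₜ_ : (s t : Triple part) → Dec (s ≡ t)
  _≟ₜ_ = ≡-dec (Finₚ._≟_ {5}) _≟ₑ_

  open DecMembership _≟ₑ_ using (_∈?_)
  open DecMembership _≟ₜ_ using () renaming (_∈?_ to _∈₃?_)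

  isEdge? : ∀ e → Dec (IsEdge part e)
  isEdge? (u , v) = (toℕ u <? toℕ v) ×-dec ¬? (part u Finₚ.≟ part v)

  isTriangle? : ∀ t → Dec (IsTriangle part t)
  isTriangle? (x , y , z) = (toℕ x <? toℕ y) ×-dec (toℕ y <? toℕ z) ×-dec
    ¬? (part x Finₚ.≟ part y) ×-dec ¬? (part x Finₚ.≟ part z) ×-dec ¬? (part y Finₚ.≟ part z)

  triangles-areTriangles : All (IsTriangle part) triangles
  triangles-areTriangles = from-yes (All.all? isTriangle? triangles)

  triangles-complete : ∀ t → IsTriangle part t → t ∈ triangles
  triangles-complete (x , y , z) = from-yes (Finₚ.all? λ x → Finₚ.all? λ y → Finₚ.all? λ z →
    isTriangle? (x , y , z) →-dec ((x , y , z) ∈₃? triangles)) x y z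

  Hits : List (Pair part) → Triple part → Set
  Hits F t = Any (_∈ F) (triEdges part t)

  hits? : ∀ F t → Dec (Hits F t)
  hits? F t = Any.any? (_∈? F) (triEdges part t)

  -- Decided by exhaustion over arbitrary pairs of vertices, edges or not, which allows shorter
  -- lists to be padded.
  two-edges-insufficient : ∀ e f → ¬ All (Hits (e ∷ f ∷ [])) triangles
  two-edges-insufficient (u , v) (x , y) = from-yes (Finₚ.all? λ u → Finₚ.all? λ v → Finₚ.all? λ x → Finₚ.all? λ y →
    ¬? (All.all? (hits? ((u , v) ∷ (x , y) ∷ [])) triangles)) u v x y

  tau : IsTau part 3
  tau = (F , ((F-unique , from-yes (All.all? isEdge? F)) , hit) , refl) , minimal
    where
    -- Deleting the triangle on 2, 3, 4 leaves the bipartite graph between {0, 1} and {2, 3, 4}.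
    F = (# 2 , # 3) ∷ (# 2 , # 4) ∷ (# 3 , # 4) ∷ []
    F-unique : Unique F
    F-unique = ((λ ()) ∷ (λ ()) ∷ []) ∷ ((λ ()) ∷ []) ∷ [] ∷ []
    hit : ∀ t → IsTriangle part t → Hits F t
    hit t isT = All.lookup (from-yes (All.all? (hits? F) triangles)) (triangles-complete t isT)
    insufficient : ∀ {G e f} → (∀ {x} → x ∈ G → x ∈ e ∷ f ∷ []) → IsTransversal part G → ⊥
    insufficient {e = e} {f} G⊆ (_ , hitG) = two-edges-insufficient e f
      (All.map (λ isT → Any.map G⊆ (hitG _ isT)) triangles-areTriangles)
    minimal : ∀ G → IsTransversal part G → 3 ≤ length G
    -- Lists of fewer than two edges are padded, here with the dummy pair (0, 0).
    minimal [] tr = ⊥-elim (insufficient {e = # 0 , # 0} {# 0 , # 0} (λ ()) tr)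
    minimal (e ∷ []) tr = ⊥-elim (insufficient {e = e} {e} (λ { (here p) → here p }) tr)
    minimal (e ∷ f ∷ []) tr = ⊥-elim (insufficient (λ p → p) tr)
    minimal (_ ∷ _ ∷ _ ∷ _) _ = s≤s (s≤s (s≤s z≤n))

  -- Quantifying over the list of edges makes edge-disjointness decidable.
  Disjoint : Triple part → Triple part → Set
  Disjoint s t = All (λ e → ¬ e ∈ triEdges part t) (triEdges part s)

  disjoint? : ∀ s t → Dec (Disjoint s t)
  disjoint? s t = All.all? (λ e → ¬? (e ∈? triEdges part t)) (triEdges part s)

  edgeDisjoint⇒Disjoint : ∀ {s t} → EdgeDisjoint part s t → Disjoint s t
  edgeDisjoint⇒Disjoint s#t = All.tabulate (s#t _)

  -- Checked on all triples of the seven triangles. The underlying obstruction is that three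
  -- disjoint triangles would use all nine edges, while vertex 0 has odd degree 3.
  no-three-disjoint : All (λ s → All (λ t → All (λ u → ¬ (Disjoint s t × Disjoint s u × Disjoint t u))
    triangles) triangles) triangles
  no-three-disjoint = from-yes (All.all? (λ s → All.all? (λ t → All.all? (λ u →
    ¬? (disjoint? s t ×-dec disjoint? s u ×-dec disjoint? t u)) triangles) triangles) triangles)

  nu : IsNu part 2
  nu = (T , (from-yes (All.all? isTriangle? T) , (disjoint ∷ []) ∷ [] ∷ []) , refl) , maximal
    where
    s = # 0 , # 2 , # 3
    t = # 1 , # 2 , # 4
    T : List (Triple part)
    T = s ∷ t ∷ []
    disjoint : EdgeDisjoint part s t
    disjoint e e∈s e∈t = All.lookup (from-yes (disjoint? s t)) e∈s e∈t
    maximal : ∀ T → IsPacking part T → length T ≤ 2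
    maximal [] _ = z≤n
    maximal (_ ∷ []) _ = s≤s z≤n
    maximal (_ ∷ _ ∷ []) _ = s≤s (s≤s z≤n)
    maximal (s ∷ t ∷ u ∷ _) (sT ∷ tT ∷ uT ∷ _ , (st ∷ su ∷ _) ∷ (tu ∷ _) ∷ _) = ⊥-elim
      (All.lookup (All.lookup (All.lookup no-three-disjoint (triangles-complete s sT)) (triangles-complete t tT))
        (triangles-complete u uT)
        (edgeDisjoint⇒Disjoint st , edgeDisjoint⇒Disjoint su , edgeDisjoint⇒Disjoint tu))

theorem3 : ((n : ℕ) → (part : Fin n → Fin 4) → IsFourPartition n part → 5 ≤ n →
    (t v : ℕ) → IsTau part t → IsNu part v → 2 * t ≤ 3 * v)
    × (Σ (Fin 5 → Fin 4) λ part → IsFourPartition 5 part ×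
    ∃ λ t → ∃ λ v → IsTau part t × IsNu part v × 2 * t ≡ 3 * v)
theorem3 = (λ n part surj 5≤n t v → UpperBound.bound-all part surj 5≤n)
  , K₂₁₁₁.part , K₂₁₁₁.surjective , 3 , 2 , K₂₁₁₁.tau , K₂₁₁₁.nu , refl
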